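{- Every normal PO-dilator has a Kruskal derivative.
   Context: A quasi embedding between partial orders $X,Y$ is a function $f$ with $f(x)\leq_Y f(y)\Rightarrow x\leq_X y$; an embedding also satisfies the converse. $\mathrm{PO}$ is the category of partial orders and quasi embeddings. $[X]^{<\omega}$ denotes the finite subsets of $X$, with $[f]^{<\omega}(a)=\{f(x)\mid x\in a\}$. A PO-dilator is a functor $W:\mathrm{PO}\to\mathrm{PO}$ mapping embeddings to embeddings, with a natural transformation $\operatorname{supp}^W:W\Rightarrow[\cdot]^{<\omega}$ such that for every embedding $f:X\to Y$, $\operatorname{rng}(W(f))=\{\sigma\in W(Y)\mid\operatorname{supp}^W_Y(\sigma)\subseteq\operatorname{rng}(f)\}$. For finite $a,b\subseteq X$, $a\leq^{\mathrm{fin}}_X b$ iff every $x\in a$ has some $y\in b$ with $x\leq_X y$ ($z\leq^{\mathrm{fin}}_X b$ means $\{z\}\leq^{\mathrm{fin}}_X b$). $W$ is normal if $\sigma\leq_{W(X)}\tau$ implies $\operatorname{supp}^W_X(\sigma)\leq^{\mathrm{fin}}_X\operatorname{supp}^W_X(\tau)$. A Kruskal fixed point of $W$ over a partial order $X$ is a partial order $Z$ with functions $\iota:X\to Z$, $\kappa:W(Z)\to Z$ such that $\operatorname{rng}(\iota)\cap\operatorname{rng}(\kappa)=\emptyset$ and, for all $x,y\in X$, $\sigma,\tau\in W(Z)$: $\iota(x)\leq_Z\iota(y)\Rightarrow x\leq_X y$; $\iota(x)\leq_Z\kappa(\tau)$ iff $\iota(x)\leq^{\mathrm{fin}}_Z\operatorname{supp}^W_Z(\tau)$;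 $\kappa(\sigma)\not\leq_Z\iota(y)$; $\kappa(\sigma)\leq_Z\kappa(\tau)$ iff ($\sigma\leq_{W(Z)}\tau$ or $\kappa(\sigma)\leq^{\mathrm{fin}}_Z\operatorname{supp}^W_Z(\tau)$). It is initial if for every Kruskal fixed point $(Z',\iota',\kappa')$ of $W$ over $X$ there is a unique quasi embedding $f:Z\to Z'$ with $f\circ\iota=\iota'$ and $f\circ\kappa=\kappa'\circ W(f)$. A Kruskal derivative of a normal PO-dilator $W$ is a tuple $(\mathcal T W,\iota,\kappa)$ consisting of a normal PO-dilator $\mathcal T W$ and families of functions $\iota_X:X\to\mathcal T W(X)$, $\kappa_X:W(\mathcal T W(X))\to\mathcal T W(X)$ indexed by partial orders $X$ such that (i) $(\mathcal T W(X),\iota_X,\kappa_X)$ is an initial Kruskal fixed point of $W$ over $X$ for each $X$, and (ii) $\iota_Y\circ f=\mathcal T W(f)\circ\iota_X$ and $\mathcal T W(f)\circ\kappa_X=\kappa_Y\circ W(\mathcal T W(f))$ for every quasi embedding $f:X\to Y$. -}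

module Defs where

open import Data.List.Base using (List; [_]; map)
open import Data.List.Relation.Binary.Subset.Setoid using (_⊆_)
open import Data.List.Relation.Unary.All using (All)
open import Data.List.Relation.Unary.Any using (Any)
open import Data.Product using (∃; ∃!; _×_)
open import Data.Sum.Base using (_⊎_)
open import Function.Base using (id; _∘_)
open import Function.Bundles using (Func; _⇔_)
open import Level using (Level; suc)
open import Relation.Binary.Bundles using (Poset; Setoid)
open import Relation.Nullary.Negation using (¬_)

private
  variable
    ℓ : Level

-- A partial order comes with an equivalence _≈_ that plays the role of
-- equality.  Hence functions between partial orders are required to respect
-- _≈_, and equality of functions is pointwise _≈_.

PO : (ℓ : Level) → Set (suc ℓ)
PO ℓ = Poset ℓ ℓ ℓ

∣_∣ : PO ℓ → Set ℓ
∣ X ∣ = Poset.Carrier X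

infix 4 Equal LessEq FinLessEq SetEqual _∈rng_ _⊆rng_ _≗_
infixr 9 _∘Q_

Equal : (X : PO ℓ) → ∣ X ∣ → ∣ X ∣ → Set ℓ
Equal X = Poset._≈_ X

LessEq : (X : PO ℓ) → ∣ X ∣ → ∣ X ∣ → Set ℓ
LessEq X = Poset._≤_ X

syntax Equal X x y = x ≈[ X ] y
syntax LessEq X x y = x ≤[ X ] y

Map : PO ℓ → PO ℓ → Set ℓ
Map X Y = Func (Poset.Eq.setoid X) (Poset.Eq.setoid Y)

_∈rng_ : {S T : Setoid ℓ ℓ} → Setoid.Carrier T → Func S T → Set ℓ
_∈rng_ {T = T} y f = ∃ λ x → Setoid._≈_ T (Func.to f x) y

record QuasiEmbedding (X Y : PO ℓ) : Set ℓ where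
  field
    function : Map X Y

  open Func function public using (to; cong)

  field
    reflects : ∀ {x y} → to x ≤[ Y ] to y → x ≤[ X ] y

open QuasiEmbedding using (function; to)

IsEmbedding : {X Y : PO ℓ} → QuasiEmbedding X Y → Set ℓ
IsEmbedding {X = X} {Y = Y} f = ∀ {x y} → x ≤[ X ] y → to f x ≤[ Y ] to f y

_≗_ : {X Y : PO ℓ} → QuasiEmbedding X Y → QuasiEmbedding X Y → Set ℓ
_≗_ {Y = Y} f g = ∀ x → to f x ≈[ Y ] to g x

idQ : {X : PO ℓ} → QuasiEmbedding X X
idQ = record
  { function = record { to = id ; cong = id }
  ; reflects = id
  }

_∘Q_ : {X Y Z : PO ℓ} →
       QuasiEmbedding Y Z → QuasiEmbedding X Y → QuasiEmbedding X Z
g ∘Q f = record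
  { function = record
      { to   = to g ∘ to f
      ; cong = QuasiEmbedding.cong g ∘ QuasiEmbedding.cong f
      }
  ; reflects = QuasiEmbedding.reflects f ∘ QuasiEmbedding.reflects g
  }

-- Finite subsets are represented by lists that enumerate them, and are
-- identified when they have the same elements.  In particular [f]^{<ω} is
-- `map`, and x is an element of xs when `Any (x ≈_) xs`.

FinSub : PO ℓ → Set ℓ
FinSub X = List ∣ X ∣

SetEqual : (X : PO ℓ) → FinSub X → FinSub X → Set ℓ
SetEqual X a b = _⊆_ S a b × _⊆_ S b a
  where S = Poset.Eq.setoid X

syntax SetEqual X a b = a ≋[ X ] b

_⊆rng_ : {S T : Setoid ℓ ℓ} → List (Setoid.Carrier T) → Func S T → Set ℓ
a ⊆rng f = All (_∈rng f) a

FinLessEq : (X : PO ℓ) → FinSub X → FinSub X → Set ℓ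
FinLessEq X a b = All (λ x → Any (λ y → x ≤[ X ] y) b) a

syntax FinLessEq X a b = a ≤fin[ X ] b

record PODilator (ℓ : Level) : Set (suc ℓ) where
  field
    F₀ : PO ℓ → PO ℓ
    F₁ : {X Y : PO ℓ} → QuasiEmbedding X Y → QuasiEmbedding (F₀ X) (F₀ Y)

    -- Since arrows are equal when they are pointwise equal, the action on
    -- arrows has to respect this equality.
    F-resp-≗     : {X Y : PO ℓ} {f g : QuasiEmbedding X Y} →
                   f ≗ g → F₁ f ≗ F₁ g
    identity     : {X : PO ℓ} → F₁ (idQ {X = X}) ≗ idQ
    homomorphism : {X Y Z : PO ℓ}
                   {f : QuasiEmbedding X Y} {g : QuasiEmbedding Y Z} →
                   F₁ (g ∘Q f) ≗ F₁ g ∘Q F₁ f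

    preserves-embeddings : {X Y : PO ℓ} (f : QuasiEmbedding X Y) →
                           IsEmbedding f → IsEmbedding (F₁ f)

    supp         : (X : PO ℓ) → ∣ F₀ X ∣ → FinSub X
    supp-cong    : (X : PO ℓ) {σ τ : ∣ F₀ X ∣} →
                   σ ≈[ F₀ X ] τ → supp X σ ≋[ X ] supp X τ
    supp-natural : {X Y : PO ℓ} (f : QuasiEmbedding X Y) (σ : ∣ F₀ X ∣) →
                   supp Y (to (F₁ f) σ) ≋[ Y ] map (to f) (supp X σ)
    supp-range   : {X Y : PO ℓ} (f : QuasiEmbedding X Y) → IsEmbedding f →
                   (σ : ∣ F₀ Y ∣) →
                   (σ ∈rng function (F₁ f)) ⇔ (supp Y σ ⊆rng function f)

Normal : PODilator ℓ → Set (suc ℓ)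
Normal {ℓ} W = (X : PO ℓ) {σ τ : ∣ F₀ X ∣} →
               σ ≤[ F₀ X ] τ → supp X σ ≤fin[ X ] supp X τ
  where open PODilator W

module _ (W : PODilator ℓ) where

  open PODilator W

  record IsKruskalFixedPoint (X Z : PO ℓ) (ι : Map X Z) (κ : Map (F₀ Z) Z)
         : Set ℓ where
    private
      ι′ = Func.to ι
      κ′ = Func.to κ
    field
      disjoint : ∀ z → ¬ (z ∈rng ι × z ∈rng κ)
      ι≤ι      : ∀ x y → ι′ x ≤[ Z ] ι′ y → x ≤[ X ] y
      ι≤κ      : ∀ x τ →
                 (ι′ x ≤[ Z ] κ′ τ) ⇔ ([ ι′ x ] ≤fin[ Z ] supp Z τ)
      κ≰ι      : ∀ σ y → ¬ (κ′ σ ≤[ Z ] ι′ y)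
      κ≤κ      : ∀ σ τ →
                 (κ′ σ ≤[ Z ] κ′ τ) ⇔
                 (σ ≤[ F₀ Z ] τ ⊎ [ κ′ σ ] ≤fin[ Z ] supp Z τ)

  record KruskalFixedPoint (X : PO ℓ) : Set (suc ℓ) where
    field
      Z                   : PO ℓ
      ι                   : Map X Z
      κ                   : Map (F₀ Z) Z
      isKruskalFixedPoint : IsKruskalFixedPoint X Z ι κ

  record IsInitialKruskalFixedPoint
         (X Z : PO ℓ) (ι : Map X Z) (κ : Map (F₀ Z) Z) : Set (suc ℓ) where
    field
      isKruskalFixedPoint : IsKruskalFixedPoint X Z ι κ
      initial : (K : KruskalFixedPoint X) →
        let module K = KruskalFixedPoint K in
        ∃! _≗_ λ (f : QuasiEmbedding Z K.Z) →
          (∀ x → to f (Func.to ι x) ≈[ K.Z ] Func.to K.ι x) ×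
          (∀ σ → to f (Func.to κ σ) ≈[ K.Z ] Func.to K.κ (to (F₁ f) σ))

  record KruskalDerivative : Set (suc ℓ) where
    field
      𝒯W     : PODilator ℓ
      normal : Normal 𝒯W

    module T = PODilator 𝒯W

    field
      ι : (X : PO ℓ) → Map X (T.F₀ X)
      κ : (X : PO ℓ) → Map (F₀ (T.F₀ X)) (T.F₀ X)

      isInitial : (X : PO ℓ) →
                  IsInitialKruskalFixedPoint X (T.F₀ X) (ι X) (κ X)

      ι-natural : {X Y : PO ℓ} (f : QuasiEmbedding X Y) (x : ∣ X ∣) →
                  Func.to (ι Y) (to f x) ≈[ T.F₀ Y ]
                  to (T.F₁ f) (Func.to (ι X) x)
      κ-natural : {X Y : PO ℓ} (f : QuasiEmbedding X Y)
                  (σ : ∣ F₀ (T.F₀ X) ∣) →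
                  to (T.F₁ f) (Func.to (κ X) σ) ≈[ T.F₀ Y ]
                  Func.to (κ Y) (to (F₁ (T.F₁ f)) σ)

{-# OPTIONS --safe #-}
module Submission where

-- The initial Kruskal fixed point over X is the union of the chain Z₀ = ∅,
-- Zₙ₊₁ = X ⊎ W(Zₙ).  The inclusion k : Zₙ → Zₙ₊₁ decomposes an element into a
-- leaf or a W-term over elements of the same stage, so the order on Zₙ₊₁ can be
-- defined inductively from Zₙ: t ≤ u if both are leaves or both are terms and
-- t ≤ u there, or if t ≤ k b for some b in the support of u.  Transitivity uses
-- that W is normal, antisymmetry that decomposition is well-founded.  Supports
-- are finite, so every term over the union comes from some stage; hence
-- decomposition is invertible on the union, which makes it a fixed point.
-- Quasi embeddings into another fixed point extend uniquely from stage to stage,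
-- which gives initiality, and the action of 𝒯W on arrows is obtained by
-- regarding 𝒯W(Y) as a fixed point over X along f : X → Y.  The support of a
-- term is its set of leaves.

open import Defs
open import Data.Empty using (⊥)
import Data.Empty.Polymorphic as Polymorphic
open import Data.List.Base using (List; []; _∷_; [_]; map; _++_)
import Data.List.Membership.Setoid as Membership
import Data.List.Membership.Setoid.Properties as Membershipₚ
import Data.List.Relation.Unary.All as All
open All using ([]; _∷_)
import Data.List.Relation.Unary.Any as Any
open Any using (Any)
open import Data.Nat.Base using (ℕ; zero; suc; _⊔_; _≤′_; ≤′-refl; ≤′-step)
open import Data.Nat.Properties using (1+n≰n; ≤′-trans; ≤′⇒≤; ≤⇒≤′; m≤m⊔n; m≤n⊔m)
open import Data.Product using (Σ; ∃; _×_; _,_; proj₁; proj₂)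
import Data.Sum.Base as Sum
open Sum using (_⊎_; inj₁; inj₂)
import Data.Sum.Relation.Binary.Pointwise as Pointwise
open Pointwise using (_⊎ₛ_; inj₁; inj₂)
open import Function.Base using (id; _∘_)
open import Function.Bundles using (Func; _⇔_; mk⇔; Equivalence)
open import Induction.WellFounded using (Acc; acc; WellFounded)
import Level
open import Level using (Level)
open import Relation.Binary.Bundles using (Poset; Setoid)
open import Relation.Binary.Core using (Rel)
open import Relation.Binary.Definitions using (_Respects₂_)
import Relation.Binary.Reasoning.PartialOrder as ≤-Reasoning
import Relation.Binary.Reasoning.Setoid as ≈-Reasoning
open import Relation.Nullary.Negation using (contradiction)

open QuasiEmbedding using (function; to; cong; reflects)

private
  variable
    ℓ : Level

-- Directed unions of chains of embeddings

module DirectedUnion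
  (P : ℕ → PO ℓ) (j : ∀ n → QuasiEmbedding (P n) (P (suc n)))
  (j-embedding : ∀ n → IsEmbedding (j n)) where

  private
    module P n = Poset (P n)
    variable
      m n o : ℕ

  lift : m ≤′ n → QuasiEmbedding (P m) (P n)
  lift ≤′-refl       = idQ
  lift (≤′-step m≤n) = j _ ∘Q lift m≤n

  lift-embedding : (m≤n : m ≤′ n) → IsEmbedding (lift m≤n)
  lift-embedding ≤′-refl       = id
  lift-embedding (≤′-step m≤n) = j-embedding _ ∘ lift-embedding m≤n

  lift-unique : (p q : m ≤′ n) → lift p ≗ lift q
  lift-unique         ≤′-refl     ≤′-refl     x = P.Eq.refl _
  lift-unique         ≤′-refl     (≤′-step q) x = contradiction (≤′⇒≤ q) 1+n≰n
  lift-unique         (≤′-step p) ≤′-refl     x = contradiction (≤′⇒≤ p) 1+n≰n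
  lift-unique {n = n} (≤′-step p) (≤′-step q) x = cong (j _) (lift-unique p q x)

  lift-trans : (p : m ≤′ n) (q : n ≤′ o) → lift (≤′-trans p q) ≗ lift q ∘Q lift p
  lift-trans p ≤′-refl     x = P.Eq.refl _
  lift-trans p (≤′-step q) x = cong (j _) (lift-trans p q x)

  lift-coherent : {k : ℕ} (p : m ≤′ n) (q : n ≤′ k) (p′ : m ≤′ o) (q′ : o ≤′ k) →
                  lift q ∘Q lift p ≗ lift q′ ∘Q lift p′
  lift-coherent {k = k} p q p′ q′ x = begin
    to (lift q ∘Q lift p) x      ≈⟨ lift-trans p q x ⟨
    to (lift (≤′-trans p q)) x   ≈⟨ lift-unique (≤′-trans p q) (≤′-trans p′ q′) x ⟩
    to (lift (≤′-trans p′ q′)) x ≈⟨ lift-trans p′ q′ x ⟩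
    to (lift q′ ∘Q lift p′) x    ∎
    where open ≈-Reasoning (P.Eq.setoid k)

  Element : Set _
  Element = Σ ℕ λ n → ∣ P n ∣

  infix 4 _⊑_

  data _⊑_ : Rel Element ℓ where
    at : ∀ {x y} (p : m ≤′ o) (q : n ≤′ o) →
         to (lift p) x ≤[ P o ] to (lift q) y → (m , x) ⊑ (n , y)

  -- Both comparisons are carried to stage `o′ ⊔ o`: the given one is preserved on the way up, and
  -- the wanted one is reflected back down. Different paths into the same stage agree by
  -- `lift-coherent`.
  ⊑-at : ∀ {x y} → (m , x) ⊑ (n , y) → (p : m ≤′ o) (q : n ≤′ o) →
         to (lift p) x ≤[ P o ] to (lift q) y
  ⊑-at {o = o} {x = x} {y = y} (at {o = o′} p q x⊑y) p′ q′ = reflects (lift s) (begin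
    to (lift s ∘Q lift p′) x ≈⟨ lift-coherent p′ s p r x ⟩
    to (lift r ∘Q lift p) x  ≤⟨ lift-embedding r x⊑y ⟩
    to (lift r ∘Q lift q) y  ≈⟨ lift-coherent q r q′ s y ⟩
    to (lift s ∘Q lift q′) y ∎)
    where
    open ≤-Reasoning (P (o′ ⊔ o))
    r = ≤⇒≤′ (m≤m⊔n o′ o)
    s = ≤⇒≤′ (m≤n⊔m o′ o)

  ⊑-refl : ∀ {u} → u ⊑ u
  ⊑-refl = at ≤′-refl ≤′-refl (P.refl _)

  ⊑-trans : ∀ {u v w} → u ⊑ v → v ⊑ w → u ⊑ w
  ⊑-trans {u = l , x} {m , y} {n , z} u⊑v v⊑w =
    at p r (P.trans _ (⊑-at u⊑v p q) (⊑-at v⊑w q r))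
    where
    q = ≤⇒≤′ (m≤m⊔n m (l ⊔ n))
    p = ≤′-trans (≤⇒≤′ (m≤m⊔n l n)) (≤⇒≤′ (m≤n⊔m m (l ⊔ n)))
    r = ≤′-trans (≤⇒≤′ (m≤n⊔m l n)) (≤⇒≤′ (m≤n⊔m m (l ⊔ n)))

  -- Equality is mutual `_⊑_`: this identifies an element with its images at later stages and makes
  -- antisymmetry immediate.
  Union : PO ℓ
  Union = record
    { Carrier        = Element
    ; _≈_            = λ u v → u ⊑ v × v ⊑ u
    ; _≤_            = _⊑_
    ; isPartialOrder = record
      { isPreorder = record
        { isEquivalence = record
          { refl  = ⊑-refl , ⊑-refl
          ; sym   = λ (p , q) → q , p
          ; trans = λ (p , q) (p′ , q′) → ⊑-trans p p′ , ⊑-trans q′ q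
          }
        ; reflexive = proj₁
        ; trans     = ⊑-trans
        }
      ; antisym = _,_
      }
    }

  inj : ∀ n → QuasiEmbedding (P n) Union
  inj n = record
    { function = record
      { to   = n ,_
      ; cong = λ x≈y → at ≤′-refl ≤′-refl (P.reflexive n x≈y) ,
                       at ≤′-refl ≤′-refl (P.reflexive n (P.Eq.sym n x≈y))
      }
    ; reflects = λ x⊑y → ⊑-at x⊑y ≤′-refl ≤′-refl
    }

  inj-embedding : ∀ n → IsEmbedding (inj n)
  inj-embedding n = at ≤′-refl ≤′-refl

  inj-lift : (p : m ≤′ n) → inj n ∘Q lift p ≗ inj m
  inj-lift p x = at ≤′-refl p (P.refl _) , at p ≤′-refl (P.refl _)

  inj-j : ∀ n → inj (suc n) ∘Q j n ≗ inj n
  inj-j n = inj-lift (≤′-step ≤′-refl)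

  -- Meant for supports: together with `supp-range` it brings a W-term over the union down to a
  -- single stage.
  finite-in-stage : (a : FinSub Union) → ∃ λ n → a ⊆rng function (inj n)
  finite-in-stage []            = 0 , []
  finite-in-stage ((m , x) ∷ a) =
    let n , a⊆n = finite-in-stage a
        p = ≤⇒≤′ (m≤m⊔n m n)
        q = ≤⇒≤′ (m≤n⊔m m n)
    in m ⊔ n ,
       (to (lift p) x , inj-lift p x) ∷
       All.map (λ (y , y≈u) → to (lift q) y , Poset.Eq.trans Union (inj-lift q y) y≈u) a⊆n

  module Cocone
    {S : Setoid ℓ ℓ} (g : ∀ n → Func (P.Eq.setoid n) S)
    (g-j : ∀ n x → Setoid._≈_ S (Func.to (g (suc n)) (to (j n) x)) (Func.to (g n) x))
    where

    private module S = Setoid S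

    g-lift : (p : m ≤′ n) (x : ∣ P m ∣) → Func.to (g n) (to (lift p) x) S.≈ Func.to (g m) x
    g-lift ≤′-refl     x = S.refl
    g-lift (≤′-step p) x = S.trans (g-j _ _) (g-lift p x)

    -- The relation is arbitrary because one use is with `Below` on nodes over the union, at a point
    -- where it is not yet known to be a partial order.
    module _ (_∼_ : Rel S.Carrier ℓ) (∼-resp-≈ : _∼_ Respects₂ S._≈_) where

      monotone : (∀ n {x y} → x ≤[ P n ] y → Func.to (g n) x ∼ Func.to (g n) y) →
                 ∀ {m n x y} → (m , x) ⊑ (n , y) → Func.to (g m) x ∼ Func.to (g n) y
      monotone g-mono (at p q x⊑y) =
        proj₁ ∼-resp-≈ (g-lift q _) (proj₂ ∼-resp-≈ (g-lift p _) (g-mono _ x⊑y))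

      reflecting : (∀ n {x y} → Func.to (g n) x ∼ Func.to (g n) y → x ≤[ P n ] y) →
                   ∀ {m n x y} → Func.to (g m) x ∼ Func.to (g n) y → (m , x) ⊑ (n , y)
      reflecting g-reflects {m} {n} gx∼gy = at p q
        (g-reflects _
          (proj₁ ∼-resp-≈ (S.sym (g-lift q _)) (proj₂ ∼-resp-≈ (S.sym (g-lift p _)) gx∼gy)))
        where
        p = ≤⇒≤′ (m≤m⊔n m n)
        q = ≤⇒≤′ (m≤n⊔m m n)

    colimit : Func (Poset.Eq.setoid Union) S
    colimit = record
      { to   = λ (n , x) → Func.to (g n) x
      ; cong = λ {(m , x)} {(n , y)} (x⊑y , y⊑x) →
          let p = ≤⇒≤′ (m≤m⊔n m n)
              q = ≤⇒≤′ (m≤n⊔m m n)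
          in S.trans (S.sym (g-lift p x))
               -- Antisymmetry at the common stage turns the two comparisons into an equality there.
               (S.trans (Func.cong (g _) (P.antisym _ (⊑-at x⊑y p q) (⊑-at y⊑x q p)))
                 (g-lift q y))
      }

-- Membership in finite subsets and supports

≤fin⇒∃ : (B : PO ℓ) {a b : FinSub B} {x : ∣ B ∣} → a ≤fin[ B ] b →
         let open Membership (Poset.Eq.setoid B) in
         x ∈ a → ∃ λ y → y ∈ b × x ≤[ B ] y
≤fin⇒∃ B a≤b x∈a =
  find (All.lookupₛ B.Eq.setoid (λ x≈y → Any.map (B.≤-respˡ-≈ x≈y)) a≤b x∈a)
  where
  module B = Poset B
  open Membership B.Eq.setoid using (find)

module _ (W : PODilator ℓ) {B C : PO ℓ} (f : QuasiEmbedding B C) where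
  open PODilator W
  open Membership (Poset.Eq.setoid B) using () renaming (_∈_ to _∈ᵇ_)
  open Membership (Poset.Eq.setoid C) using () renaming (_∈_ to _∈ᶜ_)

  ∈-supp⁺ : ∀ {b σ} → b ∈ᵇ supp B σ → to f b ∈ᶜ supp C (to (F₁ f) σ)
  ∈-supp⁺ {σ = σ} b∈σ = proj₂ (supp-natural f σ)
    (Membershipₚ.∈-map⁺ (Poset.Eq.setoid B) (Poset.Eq.setoid C) (cong f) b∈σ)

  ∈-supp⁻ : ∀ {c σ} → c ∈ᶜ supp C (to (F₁ f) σ) → ∃ λ b → b ∈ᵇ supp B σ × c ≈[ C ] to f b
  ∈-supp⁻ {σ = σ} c∈fσ =
    Membershipₚ.∈-map⁻ (Poset.Eq.setoid B) (Poset.Eq.setoid C) (proj₁ (supp-natural f σ) c∈fσ)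

-- Decomposition into leaves and W-terms

module Stages (W : PODilator ℓ) (normal : Normal W) (X : PO ℓ) where

  open PODilator W
  private module X = Poset X

  -- Only a setoid: the order on nodes depends on how elements of `B` decompose and is supplied by
  -- `Below`.
  Branch : PO ℓ → Setoid ℓ ℓ
  Branch B = X.Eq.setoid ⊎ₛ Poset.Eq.setoid (F₀ B)

  branch : {B C : PO ℓ} → QuasiEmbedding B C → Func (Branch B) (Branch C)
  branch f = record
    { to   = Sum.map₂ (to (F₁ f))
    ; cong = Pointwise.map id (cong (F₁ f))
    }

  branch-∘ : {B C D : PO ℓ} (g : QuasiEmbedding C D) (f : QuasiEmbedding B C) →
             ∀ t → Setoid._≈_ (Branch D) (Func.to (branch (g ∘Q f)) t)
                                         (Func.to (branch g) (Func.to (branch f) t))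
  branch-∘ g f (inj₁ x) = inj₁ X.Eq.refl
  branch-∘ g f (inj₂ σ) = inj₂ (homomorphism σ)

  branch-resp-≗ : {B C : PO ℓ} {f g : QuasiEmbedding B C} → f ≗ g →
                  ∀ t → Setoid._≈_ (Branch C) (Func.to (branch f) t) (Func.to (branch g) t)
  branch-resp-≗ f≗g (inj₁ x) = inj₁ X.Eq.refl
  branch-resp-≗ f≗g (inj₂ σ) = inj₂ (F-resp-≗ f≗g σ)

  module _ {B : PO ℓ} where
    private
      module B = Poset B
      module C = Setoid (Branch B)
    open Membership B.Eq.setoid using (_∈_)

    infix 4 _◃_

    data _◃_ (b : ∣ B ∣) : C.Carrier → Set ℓ where
      child : ∀ {σ} → b ∈ supp B σ → b ◃ inj₂ σ

    ◃-respʳ-≈ : ∀ {b t u} → t C.≈ u → b ◃ t → b ◃ u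
    ◃-respʳ-≈ (inj₂ σ≈τ) (child b∈σ) = child (proj₁ (supp-cong B σ≈τ) b∈σ)

    -- Normality of `W` enters here; transitivity, antisymmetry and the normality of the derivative
    -- all draw on it.
    ◃-normal : ∀ {b σ τ} → σ ≤[ F₀ B ] τ → b ◃ inj₂ σ → ∃ λ c → c ◃ inj₂ τ × b B.≤ c
    ◃-normal σ≤τ (child b∈σ) =
      let c , c∈τ , b≤c = ≤fin⇒∃ B (normal B σ≤τ) b∈σ in c , child c∈τ , b≤c

  module _ {B C : PO ℓ} (f : QuasiEmbedding B C) where

    ◃-branch⁺ : ∀ {b t} → b ◃ t → to f b ◃ Func.to (branch f) t
    ◃-branch⁺ (child b∈σ) = child (∈-supp⁺ W f b∈σ)

    ◃-branch⁻ : ∀ {c t} → c ◃ Func.to (branch f) t → ∃ λ b → b ◃ t × c ≈[ C ] to f b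
    ◃-branch⁻ {t = inj₂ σ} (child c∈fσ) =
      let b , b∈σ , c≈fb = ∈-supp⁻ W f c∈fσ in b , child b∈σ , c≈fb

  record Coalgebra : Set (Level.suc ℓ) where
    field
      poset : PO ℓ
      out   : Func (Poset.Eq.setoid poset) (Branch poset)
    open Poset poset public renaming (Carrier to Element)
    open Setoid (Branch poset) public using () renaming
      (Carrier to Node; _≈_ to _≈ₙ_; refl to ≈ₙ-refl; sym to ≈ₙ-sym; trans to ≈ₙ-trans)
    open Func out public using () renaming (to to unfold; cong to unfold-cong)

    infix 4 _⊏_
    _⊏_ : Rel Element ℓ
    b ⊏ c = b ◃ unfold c

  -- These are the order clauses of a Kruskal fixed point. A child `b` is an element of the poset
  -- while `t` is a node, so `t` is compared with the decomposition of `b`.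
  data Below (S : Coalgebra) : Rel (Coalgebra.Node S) ℓ where
    leaf  : ∀ {x y} → x X.≤ y → Below S (inj₁ x) (inj₁ y)
    node  : ∀ {σ τ} → σ ≤[ F₀ (Coalgebra.poset S) ] τ → Below S (inj₂ σ) (inj₂ τ)
    below : ∀ {t u b} → b ◃ u → Below S t (Coalgebra.unfold S b) → Below S t u

  module _ {S : Coalgebra} where
    open Coalgebra S
    private module F = Poset (F₀ poset)

    Below-respʳ : ∀ {t u v} → u ≈ₙ v → Below S t u → Below S t v
    Below-respʳ (inj₁ x≈y) (leaf p)      = leaf (X.≤-respʳ-≈ x≈y p)
    Below-respʳ (inj₂ σ≈τ) (node p)      = node (F.≤-respʳ-≈ σ≈τ p)
    Below-respʳ u≈v        (below b◃u p) = below (◃-respʳ-≈ u≈v b◃u) p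

    Below-respˡ : ∀ {t u v} → t ≈ₙ u → Below S t v → Below S u v
    Below-respˡ (inj₁ x≈y) (leaf p)      = leaf (X.≤-respˡ-≈ x≈y p)
    Below-respˡ (inj₂ σ≈τ) (node p)      = node (F.≤-respˡ-≈ σ≈τ p)
    Below-respˡ t≈u        (below b◃v p) = below b◃v (Below-respˡ t≈u p)

    Below-refl : ∀ {t} → Below S t t
    Below-refl {inj₁ x} = leaf X.refl
    Below-refl {inj₂ σ} = node F.refl

    ⊏-respʳ-≈ : ∀ {b c d} → c ≈ d → b ⊏ c → b ⊏ d
    ⊏-respʳ-≈ c≈d = ◃-respʳ-≈ (unfold-cong c≈d)

    Acc-resp-≈ : ∀ {b c} → b ≈ c → Acc _⊏_ b → Acc _⊏_ c
    Acc-resp-≈ b≈c (acc rs) = acc λ a⊏c → rs (⊏-respʳ-≈ (Eq.sym b≈c) a⊏c)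

  IsMorphism : (S T : Coalgebra) → QuasiEmbedding (Coalgebra.poset S) (Coalgebra.poset T) → Set ℓ
  IsMorphism S T f = ∀ b → T.unfold (to f b) T.≈ₙ Func.to (branch f) (S.unfold b)
    where
    module S = Coalgebra S
    module T = Coalgebra T

  module Morphism {S T : Coalgebra} (f : QuasiEmbedding (Coalgebra.poset S) (Coalgebra.poset T))
                  (f-unfold : IsMorphism S T f) where
    private
      module S = Coalgebra S
      module T = Coalgebra T

    Below-branch⁺ : IsEmbedding f → ∀ {t u} → Below S t u →
                    Below T (Func.to (branch f) t) (Func.to (branch f) u)
    Below-branch⁺ f-emb (leaf p)      = leaf p
    Below-branch⁺ f-emb (node p)      = node (preserves-embeddings f f-emb p)
    Below-branch⁺ f-emb (below b◃u p) =
      below (◃-branch⁺ f b◃u) (Below-respʳ (T.≈ₙ-sym (f-unfold _)) (Below-branch⁺ f-emb p))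

    -- Children of an image are images of children, so a comparison of images descends through
    -- images only, and a quasi embedding suffices. The auxiliary `go` speaks of nodes equal to
    -- images, because a child is an image only up to equality.
    Below-branch⁻ : ∀ {t u} → Below T (Func.to (branch f) t) (Func.to (branch f) u) → Below S t u
    Below-branch⁻ p = go _ _ p T.≈ₙ-refl T.≈ₙ-refl
      where
      go : ∀ {v w} t u → Below T v w → v T.≈ₙ Func.to (branch f) t →
           w T.≈ₙ Func.to (branch f) u → Below S t u
      go (inj₁ x) (inj₁ y) (leaf p) (inj₁ e) (inj₁ e′) =
        leaf (X.≤-respˡ-≈ e (X.≤-respʳ-≈ e′ p))
      go (inj₂ σ) (inj₂ τ) (node p) (inj₂ e) (inj₂ e′) =
        node (reflects (F₁ f) (F.≤-respˡ-≈ e (F.≤-respʳ-≈ e′ p)))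
        where module F = Poset (F₀ T.poset)
      go t u (below c◃w p) e e′ =
        let b , b◃u , c≈fb = ◃-branch⁻ f (◃-respʳ-≈ e′ c◃w)
        in below b◃u (go t _ p e (T.≈ₙ-trans (T.unfold-cong c≈fb) (f-unfold b)))

    -- Every child of `to f b` equals the image of a child of `b`, so a descent from the image lifts
    -- to a descent in `S`.
    acc-image : ∀ {b} → Acc S._⊏_ b → Acc T._⊏_ (to f b)
    acc-image {b} (acc rs) = acc λ c⊏fb →
      let a , a⊏b , c≈fa = ◃-branch⁻ f (◃-respʳ-≈ (f-unfold b) c⊏fb)
      in Acc-resp-≈ {T} (T.Eq.sym c≈fa) (acc-image (rs a⊏b))

  -- Stages and their successors

  record Stage : Set (Level.suc ℓ) where
    field
      coalgebra : Coalgebra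
    open Coalgebra coalgebra public
    field
      unfold-mono     : ∀ {b c} → b ≤ c → Below coalgebra (unfold b) (unfold c)
      unfold-reflects : ∀ {b c} → Below coalgebra (unfold b) (unfold c) → b ≤ c
      wellFounded     : WellFounded _⊏_

  module _ (S : Stage) where
    open Stage S
    private
      module F = Poset (F₀ poset)
      _≼_ = Below coalgebra

    -- Lexicographic recursion on the two derivations. In the last clause normality moves the child
    -- `b` of the middle term to a child `c` above it; the second derivation is replaced by
    -- `unfold-mono b≤c`, but the first one shrinks.
    Below-trans : ∀ {t u v} → t ≼ u → u ≼ v → t ≼ v
    Below-trans p             (below b◃v q) = below b◃v (Below-trans p q)
    Below-trans (leaf p)      (leaf q)      = leaf (X.trans p q)
    Below-trans (node p)      (node q)      = node (F.trans p q)
    Below-trans (below b◃σ p) (node σ≤τ)    =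
      let c , c◃τ , b≤c = ◃-normal σ≤τ b◃σ
      in below c◃τ (Below-trans p (unfold-mono b≤c))

    ⊏⇒≤ : ∀ {b c} → b ⊏ c → b ≤ c
    ⊏⇒≤ b⊏c = unfold-reflects (below b⊏c Below-refl)

    -- The slack c ≤ b makes the statement stable under passing to a child of c.
    not-below-child : ∀ {b c t u} → Acc _⊏_ c → t ≼ u → u ≈ₙ unfold c → c ≤ b → b ◃ t → ⊥
    not-below-child (acc rs) (node σ≤τ) u≈c c≤b b◃σ =
      let d , d◃τ , b≤d = ◃-normal σ≤τ b◃σ
          d⊏c = ◃-respʳ-≈ u≈c d◃τ
      in not-below-child (rs d⊏c) (unfold-mono (trans c≤b b≤d)) ≈ₙ-refl refl d⊏c
    not-below-child (acc rs) (below d◃u p) u≈c c≤b b◃t =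
      let d⊏c = ◃-respʳ-≈ u≈c d◃u
      in not-below-child (rs d⊏c) p ≈ₙ-refl (trans (⊏⇒≤ d⊏c) c≤b) b◃t

    -- If either comparison passes through a child, transitivity puts a node below the decomposition
    -- of its own child, which well-foundedness excludes.
    Below-antisym : ∀ {t u} → t ≼ u → u ≼ t → t ≈ₙ u
    Below-antisym (leaf p)      (leaf q) = inj₁ (X.antisym p q)
    Below-antisym (node p)      (node q) = inj₂ (F.antisym p q)
    Below-antisym p             (below b◃t q) =
      contradiction b◃t (not-below-child (wellFounded _) (Below-trans p q) ≈ₙ-refl refl)
    Below-antisym (below b◃u p) q =
      contradiction b◃u (not-below-child (wellFounded _) (Below-trans q p) ≈ₙ-refl refl)

    nodePoset : PO ℓ
    nodePoset = record
      { _≈_            = _≈ₙ_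
      ; _≤_            = Below coalgebra
      ; isPartialOrder = record
        { isPreorder = record
          { isEquivalence = Setoid.isEquivalence (Branch poset)
          ; reflexive     = λ t≈u → Below-respʳ t≈u Below-refl
          ; trans         = Below-trans
          }
        ; antisym = Below-antisym
        }
      }

    unfoldQ : QuasiEmbedding poset nodePoset
    unfoldQ = record { function = out ; reflects = unfold-reflects }

    -- A node over `poset` becomes a node over `nodePoset` when each of its children is replaced by
    -- that child's own decomposition.
    nodeCoalgebra : Coalgebra
    nodeCoalgebra = record { poset = nodePoset ; out = branch unfoldQ }

    -- Both sides of the morphism equation are `branch unfoldQ` applied to `unfold b`, so
    -- reflexivity proves it.
    open Morphism {coalgebra} {nodeCoalgebra} unfoldQ (λ _ → Setoid.refl (Branch nodePoset))

    next : Stage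
    next = record
      { coalgebra       = nodeCoalgebra
      ; unfold-mono     = Below-branch⁺ unfold-mono
      ; unfold-reflects = Below-branch⁻
      -- A new node need not come from the previous stage, but its children do, and those are
      -- accessible by `acc-image`.
      ; wellFounded     = λ t → acc λ u⊏t →
          let b , _ , u≈b = ◃-branch⁻ unfoldQ {t = t} u⊏t
          in Acc-resp-≈ {nodeCoalgebra} (≈ₙ-sym u≈b) (acc-image (wellFounded b))
      }

  -- The chain of stages and its union

  emptyStage : Stage
  emptyStage = record
    { coalgebra       = record
      { poset = record
        { Carrier        = Polymorphic.⊥
        ; _≈_            = λ _ _ → Polymorphic.⊥
        ; _≤_            = λ _ _ → Polymorphic.⊥
        ; isPartialOrder = record
          { isPreorder = record
            { isEquivalence = record
              { refl  = λ { {()} }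
              ; sym   = λ { {()} }
              ; trans = λ { {()} }
              }
            ; reflexive = λ { {()} }
            ; trans     = λ { {()} }
            }
          ; antisym = λ { {()} }
          }
        }
      ; out = record { to = λ () ; cong = λ { {()} } }
      }
    ; unfold-mono     = λ { {()} }
    ; unfold-reflects = λ { {()} }
    ; wellFounded     = λ ()
    }

  stage : ℕ → Stage
  stage zero    = emptyStage
  stage (suc n) = next (stage n)

  private module S n = Stage (stage n)

  open DirectedUnion S.poset (λ n → unfoldQ (stage n)) S.unfold-mono public

  unfoldₙ : ∀ n → Func (Poset.Eq.setoid (S.poset n)) (Branch Union)
  unfoldₙ n = record
    { to   = λ x → Func.to (branch (inj n)) (S.unfold n x)
    ; cong = λ x≈y → Func.cong (branch (inj n)) (S.unfold-cong n x≈y)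
    }

  private module B = Setoid (Branch Union)

  branch-inj-unfold : ∀ n t → Func.to (branch (inj (suc n))) (Func.to (branch (unfoldQ (stage n))) t)
                      B.≈ Func.to (branch (inj n)) t
  branch-inj-unfold n t = B.trans (B.sym (branch-∘ (inj (suc n)) (unfoldQ (stage n)) t))
                                  (branch-resp-≗ {f = inj (suc n) ∘Q unfoldQ (stage n)} (inj-j n) t)

  private
    module Unfold = Cocone {Branch Union} unfoldₙ (λ n x → branch-inj-unfold n (S.unfold n x))

  abstract
    unionOut : Func (Poset.Eq.setoid Union) (Branch Union)
    unionOut = Unfold.colimit

    unionOut-inj : ∀ n x → Func.to unionOut (n , x) B.≈ Func.to (unfoldₙ n) x
    unionOut-inj n x = B.refl

  unionCoalgebra : Coalgebra
  unionCoalgebra = record { poset = Union ; out = unionOut }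

  private
    module Inj n = Morphism {S.coalgebra n} {unionCoalgebra} (inj n) (unionOut-inj n)

    Below-resp-≈ : Below unionCoalgebra Respects₂ B._≈_
    Below-resp-≈ = Below-respʳ , Below-respˡ

  abstract
    unionOut-mono : ∀ {u v} → u ⊑ v →
                    Below unionCoalgebra (Func.to unionOut u) (Func.to unionOut v)
    unionOut-mono = Unfold.monotone (Below unionCoalgebra) Below-resp-≈
      (λ n x≤y → Inj.Below-branch⁺ n (inj-embedding n) (S.unfold-mono n x≤y))

    unionOut-reflects : ∀ {u v} →
                        Below unionCoalgebra (Func.to unionOut u) (Func.to unionOut v) → u ⊑ v
    unionOut-reflects = Unfold.reflecting (Below unionCoalgebra) Below-resp-≈
      (λ n p → S.unfold-reflects n (Inj.Below-branch⁻ n p))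

  unionStage : Stage
  unionStage = record
    { coalgebra       = unionCoalgebra
    ; unfold-mono     = unionOut-mono
    ; unfold-reflects = unionOut-reflects
    ; wellFounded     = λ (n , x) → Inj.acc-image n (S.wellFounded n x)
    }

  open Stage unionStage using (unfold; unfold-mono; unfold-reflects; unfold-cong; _⊏_; wellFounded)
  private module U = Poset Union

  _≼_ : Rel B.Carrier ℓ
  _≼_ = Below unionCoalgebra

  abstract
    -- The finite support of `σ` lies in some stage `n`. The range condition for the embedding
    -- `inj n` then yields a preimage `τ` over that stage, and `inj₂ τ` is an element of the next
    -- one.
    unfold-surjective : ∀ t → ∃ λ u → unfold u B.≈ t
    -- Stage 0 is empty, so leaves first occur at stage 1.
    unfold-surjective (inj₁ x) = (1 , inj₁ x) , unionOut-inj 1 (inj₁ x)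
    unfold-surjective (inj₂ σ) =
      let n , σ⊆n  = finite-in-stage (supp Union σ)
          τ , nτ≈σ = Equivalence.from (supp-range (inj n) (inj-embedding n) σ) σ⊆n
      in (suc n , inj₂ τ) , B.trans (unionOut-inj (suc n) (inj₂ τ))
                              (B.trans (branch-inj-unfold n (inj₂ τ)) (inj₂ nτ≈σ))

  -- The Kruskal fixed point on the union

  roll : B.Carrier → U.Carrier
  roll t = proj₁ (unfold-surjective t)

  unfold-roll : ∀ t → unfold (roll t) B.≈ t
  unfold-roll t = proj₂ (unfold-surjective t)

  roll-≤⁺ : ∀ {t b} → t ≼ unfold b → roll t U.≤ b
  roll-≤⁺ p = unfold-reflects (Below-respˡ (B.sym (unfold-roll _)) p)

  roll-≤⁻ : ∀ {t b} → roll t U.≤ b → t ≼ unfold b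
  roll-≤⁻ p = Below-respˡ (unfold-roll _) (unfold-mono p)

  roll-≤-roll⁺ : ∀ {t u} → t ≼ u → roll t U.≤ roll u
  roll-≤-roll⁺ p = roll-≤⁺ (Below-respʳ (B.sym (unfold-roll _)) p)

  roll-≤-roll⁻ : ∀ {t u} → roll t U.≤ roll u → t ≼ u
  roll-≤-roll⁻ p = Below-respʳ (unfold-roll _) (roll-≤⁻ p)

  -- The chosen preimages of equal nodes are equal because `unfold` reflects the order.
  roll-cong : ∀ {t u} → t B.≈ u → roll t U.≈ roll u
  roll-cong t≈u = roll-≤-roll⁺ (Below-respʳ t≈u Below-refl) ,
                  roll-≤-roll⁺ (Below-respˡ t≈u Below-refl)

  roll-unfold : ∀ b → roll (unfold b) U.≈ b
  roll-unfold b = roll-≤⁺ Below-refl ,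
                  unfold-reflects (Below-respʳ (B.sym (unfold-roll _)) Below-refl)

  ιᵁ : Map X Union
  ιᵁ = record { to = roll ∘ inj₁ ; cong = roll-cong ∘ inj₁ }

  κᵁ : Map (F₀ Union) Union
  κᵁ = record { to = roll ∘ inj₂ ; cong = roll-cong ∘ inj₂ }

  open Membership U.Eq.setoid using (find; lose) renaming (_∈_ to _∈ᵁ_)

  below-some : ∀ {t τ} → Any (roll t U.≤_) (supp Union τ) → t ≼ inj₂ τ
  below-some p = let b , b∈τ , t≤b = find p in below (child b∈τ) (roll-≤⁻ t≤b)

  union-isKruskalFixedPoint : IsKruskalFixedPoint W X Union ιᵁ κᵁ
  union-isKruskalFixedPoint = record
    { disjoint = λ { z ((x , ιx≈z) , (σ , κσ≈z)) →
        κ≰ι σ x (proj₁ (U.Eq.trans κσ≈z (U.Eq.sym ιx≈z))) }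
    ; ι≤ι      = λ x y ιx≤ιy → ι≤ι (roll-≤-roll⁻ ιx≤ιy)
    ; ι≤κ      = λ x τ → mk⇔ (λ p → ι≤κ (roll-≤-roll⁻ p))
        (λ { (p ∷ []) → roll-≤-roll⁺ (below-some p) })
    ; κ≰ι      = κ≰ι
    ; κ≤κ      = λ σ τ → mk⇔ (λ p → κ≤κ (roll-≤-roll⁻ p))
        λ { (inj₁ σ≤τ)      → roll-≤-roll⁺ (node σ≤τ)
          ; (inj₂ (p ∷ [])) → roll-≤-roll⁺ (below-some p) }
    }
    where
    ι≤ι : ∀ {x y} → inj₁ x ≼ inj₁ y → x X.≤ y
    ι≤ι (leaf x≤y) = x≤y
    ι≤κ : ∀ {x τ} → inj₁ x ≼ inj₂ τ → [ roll (inj₁ x) ] ≤fin[ Union ] supp Union τ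
    ι≤κ (below (child b∈τ) p) = lose U.≤-respʳ-≈ b∈τ (roll-≤⁺ p) ∷ []
    κ≤κ : ∀ {σ τ} → inj₂ σ ≼ inj₂ τ →
          σ ≤[ F₀ Union ] τ ⊎ [ roll (inj₂ σ) ] ≤fin[ Union ] supp Union τ
    κ≤κ (node σ≤τ)            = inj₁ σ≤τ
    κ≤κ (below (child b∈τ) p) = inj₂ (lose U.≤-respʳ-≈ b∈τ (roll-≤⁺ p) ∷ [])
    κ≰ι : ∀ σ y → roll (inj₂ σ) U.≤ roll (inj₁ y) → ⊥
    κ≰ι σ y p = node⋠leaf (roll-≤-roll⁻ p)
      where
      node⋠leaf : ∀ {σ y} → inj₂ σ ≼ inj₁ y → ⊥
      node⋠leaf (below () _)

  -- Leaves of a term as its support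

  open Membership X.Eq.setoid using () renaming (_∈_ to _∈ˣ_)

  data Leaf (x : ∣ X ∣) : B.Carrier → Set ℓ where
    here   : ∀ {y} → x X.≈ y → Leaf x (inj₁ y)
    inside : ∀ {t b} → b ◃ t → Leaf x (unfold b) → Leaf x t

  Leaf-respˡ : ∀ {x y t} → x X.≈ y → Leaf x t → Leaf y t
  Leaf-respˡ x≈y (here x≈z)       = here (X.Eq.trans (X.Eq.sym x≈y) x≈z)
  Leaf-respˡ x≈y (inside b◃t x∈b) = inside b◃t (Leaf-respˡ x≈y x∈b)

  Leaf-respʳ : ∀ {x t u} → t B.≈ u → Leaf x t → Leaf x u
  Leaf-respʳ (inj₁ y≈z) (here x≈y)       = here (X.Eq.trans x≈y y≈z)
  Leaf-respʳ t≈u        (inside b◃t x∈b) = inside (◃-respʳ-≈ t≈u b◃t) x∈b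

  -- A `below` step only lengthens the path to the leaf. In the `node` case normality of `W`
  -- replaces the child `b` on the path by some `c` above it, and the path below `b` is shorter.
  Leaf-normal : ∀ {x t u} → Leaf x t → t ≼ u → ∃ λ y → Leaf y u × x X.≤ y
  Leaf-normal x∈t (below b◃u t≼b) =
    let y , y∈b , x≤y = Leaf-normal x∈t t≼b in y , inside b◃u y∈b , x≤y
  Leaf-normal (here x≈y) (leaf y≤z) = _ , here X.Eq.refl , X.≤-respˡ-≈ (X.Eq.sym x≈y) y≤z
  Leaf-normal (inside b◃σ x∈b) (node σ≤τ) =
    let c , c◃τ , b≤c = ◃-normal σ≤τ b◃σ
        y , y∈c , x≤y = Leaf-normal x∈b (unfold-mono b≤c)
    in y , inside c◃τ y∈c , x≤y

  Enumerates : List ∣ X ∣ → (∣ X ∣ → Set ℓ) → Set ℓ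
  Enumerates a P = ∀ x → x ∈ˣ a ⇔ P x

  enumerate-Any : (bs : FinSub Union) →
                  (∀ {b} → b ∈ᵁ bs → ∃ λ a → Enumerates a (λ x → Leaf x (unfold b))) →
                  ∃ λ a → Enumerates a (λ x → Any (λ b → Leaf x (unfold b)) bs)
  enumerate-Any []       enum = [] , λ x → mk⇔ (λ ()) (λ ())
  enumerate-Any (b ∷ bs) enum =
    let a , a⇔ = enum (Any.here U.Eq.refl)
        c , c⇔ = enumerate-Any bs (enum ∘ Any.there)
    in a ++ c , λ x → mk⇔
         (λ x∈ac → Sum.[ Any.here ∘ Equivalence.to (a⇔ x) , Any.there ∘ Equivalence.to (c⇔ x) ]
                     (Membershipₚ.∈-++⁻ X.Eq.setoid a x∈ac))
         (λ { (Any.here p)  → Membershipₚ.∈-++⁺ˡ X.Eq.setoid (Equivalence.from (a⇔ x) p)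
            ; (Any.there p) → Membershipₚ.∈-++⁺ʳ X.Eq.setoid a (Equivalence.from (c⇔ x) p) })

  enumerate-Leaf : ∀ {b} → Acc _⊏_ b → ∃ λ a → Enumerates a (λ x → Leaf x (unfold b))
  -- The decomposition is passed on as a variable `t`, with the enumerations for its children, so
  -- that it can be split into leaf and term.
  enumerate-Leaf {b} (acc rs) = go (unfold b) (λ c⊏b → enumerate-Leaf (rs c⊏b))
    where
    go : ∀ t → (∀ {c} → c ◃ t → ∃ λ a → Enumerates a (λ x → Leaf x (unfold c))) →
         ∃ λ a → Enumerates a (λ x → Leaf x t)
    go (inj₁ y) enum = [ y ] , λ x → mk⇔
      (λ { (Any.here x≈y) → here x≈y })
      (λ { (here x≈y) → Any.here x≈y })
    go (inj₂ σ) enum =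
      let a , a⇔ = enumerate-Any (supp Union σ) (enum ∘ child)
      in a , λ x → mk⇔
        (λ x∈a → let c , c∈σ , x∈c = find (Equivalence.to (a⇔ x) x∈a) in inside (child c∈σ) x∈c)
        (λ { (inside (child c∈σ) x∈c) → Equivalence.from (a⇔ x)
               (lose (λ c≈d → Leaf-respʳ (unfold-cong c≈d)) c∈σ x∈c) })

  abstract
    leaves : U.Carrier → FinSub X
    leaves b = proj₁ (enumerate-Leaf (wellFounded b))

    ∈-leaves : ∀ b x → x ∈ˣ leaves b ⇔ Leaf x (unfold b)
    ∈-leaves b = proj₂ (enumerate-Leaf (wellFounded b))

  module _ {b : U.Carrier} {x : ∣ X ∣} where
    open Equivalence (∈-leaves b x) public using () renaming (to to ∈-leaves⁻; from to ∈-leaves⁺)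

  leaves-cong : ∀ {b c} → b U.≈ c → leaves b ≋[ X ] leaves c
  leaves-cong b≈c =
    ∈-leaves⁺ ∘ Leaf-respʳ (unfold-cong b≈c) ∘ ∈-leaves⁻ ,
    ∈-leaves⁺ ∘ Leaf-respʳ (B.sym (unfold-cong b≈c)) ∘ ∈-leaves⁻

  leaves-normal : ∀ {b c} → b U.≤ c → leaves b ≤fin[ X ] leaves c
  leaves-normal b≤c = All.tabulateₛ X.Eq.setoid λ x∈b →
    let y , y∈c , x≤y = Leaf-normal (∈-leaves⁻ x∈b) (unfold-mono b≤c)
    in Membership.lose X.Eq.setoid X.≤-respʳ-≈ (∈-leaves⁺ y∈c) x≤y

  -- Initiality: evaluation in an arbitrary fixed point

  module Eval (K : KruskalFixedPoint W X) where

    open KruskalFixedPoint K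
    private
      module K = IsKruskalFixedPoint isKruskalFixedPoint
      module Z = Poset Z
      open Membership Z.Eq.setoid using () renaming (find to findᶻ; lose to loseᶻ)

    eval : {B : PO ℓ} → QuasiEmbedding B Z → Func (Branch B) Z.Eq.setoid
    eval f = record
      { to   = Sum.[ Func.to ι , Func.to κ ∘ to (F₁ f) ]
      ; cong = λ { (inj₁ x≈y) → Func.cong ι x≈y
                 ; (inj₂ σ≈τ) → Func.cong κ (cong (F₁ f) σ≈τ) }
      }

    eval-branch : {B C : PO ℓ} (g : QuasiEmbedding C Z) (f : QuasiEmbedding B C) →
                  ∀ t → Func.to (eval g) (Func.to (branch f) t) Z.≈ Func.to (eval (g ∘Q f)) t
    eval-branch g f (inj₁ x) = Z.Eq.refl
    eval-branch g f (inj₂ σ) = Func.cong κ (Poset.Eq.sym (F₀ Z) (homomorphism σ))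

    eval-resp-≗ : {B : PO ℓ} {f g : QuasiEmbedding B Z} → f ≗ g →
                  ∀ t → Func.to (eval f) t Z.≈ Func.to (eval g) t
    eval-resp-≗ f≗g (inj₁ x) = Z.Eq.refl
    eval-resp-≗ f≗g (inj₂ σ) = Func.cong κ (F-resp-≗ f≗g σ)

    below⁺ : {B : PO ℓ} (f : QuasiEmbedding B Z) → ∀ t {u b} → b ◃ u →
             Func.to (eval f) t Z.≤ to f b → Func.to (eval f) t Z.≤ Func.to (eval f) u
    below⁺ f t (child b∈τ) t≤b with ◃-branch⁺ f (child b∈τ)
    below⁺ f (inj₁ x) (child b∈τ) t≤b | child fb∈τ =
      Equivalence.from (K.ι≤κ _ _) (loseᶻ Z.≤-respʳ-≈ fb∈τ t≤b ∷ [])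
    below⁺ f (inj₂ σ) (child b∈τ) t≤b | child fb∈τ =
      Equivalence.from (K.κ≤κ _ _) (inj₂ (loseᶻ Z.≤-respʳ-≈ fb∈τ t≤b ∷ []))

    below⁻ : {B : PO ℓ} (f : QuasiEmbedding B Z) → ∀ {z τ} →
             Any (z Z.≤_) (supp Z (to (F₁ f) τ)) → ∃ λ b → b ◃ inj₂ τ × z Z.≤ to f b
    below⁻ f {τ = τ} p =
      let c , c∈fτ , z≤c = findᶻ p
          b , b◃τ , c≈fb = ◃-branch⁻ f {t = inj₂ τ} (child c∈fτ)
      in b , b◃τ , Z.≤-respʳ-≈ c≈fb z≤c

    -- Stated through decomposition, so that it makes sense at every stage, where no `ι` and `κ`
    -- back into the same stage are available.
    IsHom : (S : Coalgebra) → QuasiEmbedding (Coalgebra.poset S) Z → Set ℓ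
    IsHom S f = ∀ b → to f b Z.≈ Func.to (eval f) (Coalgebra.unfold S b)

    module _ (S : Stage) (f : QuasiEmbedding (Stage.poset S) Z)
             (f-hom : IsHom (Stage.coalgebra S) f) where

      private module T = Stage S

      -- The fixed point conditions of `K` turn a comparison in `Z` into a direct one or into one
      -- with the image of a child of `u`; the latter is left to the recursive hypothesis.
      reflects-step : ∀ t u →
        (∀ {b} → b ◃ u → Func.to (eval f) t Z.≤ to f b → Below T.coalgebra t (T.unfold b)) →
        Func.to (eval f) t Z.≤ Func.to (eval f) u → Below T.coalgebra t u
      reflects-step t (inj₂ τ) rec p = go t rec p
        where
        descend : ∀ {t} →
          (∀ {b} → b ◃ inj₂ τ → Func.to (eval f) t Z.≤ to f b → Below T.coalgebra t (T.unfold b)) →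
          Any (Func.to (eval f) t Z.≤_) (supp Z (to (F₁ f) τ)) → Below T.coalgebra t (inj₂ τ)
        descend rec p = let b , b◃τ , t≤fb = below⁻ f p in below b◃τ (rec b◃τ t≤fb)

        go : ∀ t →
          (∀ {b} → b ◃ inj₂ τ → Func.to (eval f) t Z.≤ to f b → Below T.coalgebra t (T.unfold b)) →
          Func.to (eval f) t Z.≤ Func.to κ (to (F₁ f) τ) → Below T.coalgebra t (inj₂ τ)
        go (inj₁ x) rec p with Equivalence.to (K.ι≤κ x _) p
        ... | q ∷ [] = descend rec q
        go (inj₂ σ) rec p with Equivalence.to (K.κ≤κ _ _) p
        ... | inj₁ q        = node (reflects (F₁ f) q)
        ... | inj₂ (q ∷ []) = descend rec q
      reflects-step (inj₁ x) (inj₁ y) rec p = leaf (K.ι≤ι x y p)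
      reflects-step (inj₂ σ) (inj₁ y) rec p = contradiction p (K.κ≰ι _ y)

      -- The left node `t` stays fixed while well-founded recursion descends through the children of
      -- `u`.
      eval-reflects : ∀ t u → Func.to (eval f) t Z.≤ Func.to (eval f) u → Below T.coalgebra t u
      eval-reflects t u = reflects-step t u (λ {b} _ → at-element (T.wellFounded b))
        where
        at-element : ∀ {b} → Acc T._⊏_ b →
                     Func.to (eval f) t Z.≤ to f b → Below T.coalgebra t (T.unfold b)
        at-element {b} (acc rs) p = reflects-step t (T.unfold b)
          (λ c⊏b → at-element (rs c⊏b)) (Z.≤-respʳ-≈ (f-hom b) p)

      -- A fixed point only demands that `ι` reflect the order, so monotonicity of `ι` is assumed;
      -- it becomes available when an embedding is lifted to the derivative.
      eval-mono : (∀ {x y} → x X.≤ y → Func.to ι x Z.≤ Func.to ι y) → IsEmbedding f →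
                  ∀ {t u} → Below T.coalgebra t u → Func.to (eval f) t Z.≤ Func.to (eval f) u
      eval-mono ι-mono f-emb (leaf x≤y)    = ι-mono x≤y
      eval-mono ι-mono f-emb (node σ≤τ)    =
        Equivalence.from (K.κ≤κ _ _) (inj₁ (preserves-embeddings f f-emb σ≤τ))
      eval-mono ι-mono f-emb (below {t} b◃u p) =
        below⁺ f t b◃u (Z.≤-respʳ-≈ (Z.Eq.sym (f-hom _)) (eval-mono ι-mono f-emb p))

      evalQ : QuasiEmbedding (nodePoset S) Z
      evalQ = record { function = eval f ; reflects = eval-reflects _ _ }

      evalQ-unfold : evalQ ∘Q unfoldQ S ≗ f
      evalQ-unfold b = Z.Eq.sym (f-hom b)

      evalQ-hom : IsHom (nodeCoalgebra S) evalQ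
      -- Since `f` factors as `evalQ ∘Q unfoldQ S`, evaluating `t` along `f` amounts to decomposing
      -- its children and evaluating along `evalQ`.
      evalQ-hom t = Z.Eq.trans (eval-resp-≗ {f = f} {g = evalQ ∘Q unfoldQ S} f-hom t)
                               (Z.Eq.sym (eval-branch evalQ (unfoldQ S) t))

    mutual
      -- Simultaneous with `foldₙ-hom`, since reflecting the order at the next stage relies on the
      -- homomorphism equation at this one.
      foldₙ : ∀ n → QuasiEmbedding (S.poset n) Z
      foldₙ zero    = record
        { function = record { to = λ () ; cong = λ { {()} } }
        ; reflects = λ { {()} }
        }
      foldₙ (suc n) = evalQ (stage n) (foldₙ n) (foldₙ-hom n)

      foldₙ-hom : ∀ n → IsHom (S.coalgebra n) (foldₙ n)
      foldₙ-hom zero    ()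
      foldₙ-hom (suc n) = evalQ-hom (stage n) (foldₙ n) (foldₙ-hom n)

    private
      module Fold = Cocone {Z.Eq.setoid} (λ n → function (foldₙ n))
                      (λ n → evalQ-unfold (stage n) (foldₙ n) (foldₙ-hom n))

    abstract
      fold : QuasiEmbedding Union Z
      fold = record
        { function = Fold.colimit
        ; reflects = Fold.reflecting Z._≤_ Z.≤-resp-≈ (λ n → reflects (foldₙ n))
        }

      fold-hom : IsHom unionCoalgebra fold
      fold-hom (n , x) = begin
        to (foldₙ n) x
          ≈⟨ foldₙ-hom n x ⟩
        Func.to (eval (foldₙ n)) (S.unfold n x)
          ≈⟨ eval-resp-≗ {f = foldₙ n} {g = fold ∘Q inj n} (λ _ → Z.Eq.refl) (S.unfold n x) ⟩
        Func.to (eval (fold ∘Q inj n)) (S.unfold n x)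
          ≈⟨ eval-branch fold (inj n) (S.unfold n x) ⟨
        Func.to (eval fold) (Func.to (unfoldₙ n) x)
          ≈⟨ Func.cong (eval fold) (unionOut-inj n x) ⟨
        Func.to (eval fold) (unfold (n , x))
          ∎
        where open ≈-Reasoning Z.Eq.setoid

      fold-embedding : (∀ {x y} → x X.≤ y → Func.to ι x Z.≤ Func.to ι y) → IsEmbedding fold
      fold-embedding ι-mono = Fold.monotone Z._≤_ Z.≤-resp-≈ foldₙ-mono
        where
        foldₙ-mono : ∀ n → IsEmbedding (foldₙ n)
        foldₙ-mono zero    {()}
        foldₙ-mono (suc n) = eval-mono (stage n) (foldₙ n) (foldₙ-hom n) ι-mono (foldₙ-mono n)

    -- A homomorphism is determined at stage `suc n` by its restriction to stage `n`; uniqueness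
    -- follows by induction from the empty stage.
    hom-at-stage : ∀ f → IsHom unionCoalgebra f → ∀ n (t : S.Element (suc n)) →
                   to f (suc n , t) Z.≈ Func.to (eval (f ∘Q inj n)) t
    hom-at-stage f f-hom n t = begin
      to f (suc n , t)
        ≈⟨ f-hom (suc n , t) ⟩
      Func.to (eval f) (unfold (suc n , t))
        ≈⟨ Func.cong (eval f) (B.trans (unionOut-inj (suc n) t) (branch-inj-unfold n t)) ⟩
      Func.to (eval f) (Func.to (branch (inj n)) t)
        ≈⟨ eval-branch f (inj n) t ⟩
      Func.to (eval (f ∘Q inj n)) t
        ∎
      where open ≈-Reasoning Z.Eq.setoid

    hom-unique : ∀ {f g} → IsHom unionCoalgebra f → IsHom unionCoalgebra g → f ≗ g
    hom-unique {f} {g} f-hom g-hom (n , x) = go n x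
      where
      go : ∀ n → f ∘Q inj n ≗ g ∘Q inj n
      go zero    ()
      go (suc n) t = Z.Eq.trans (hom-at-stage f f-hom n t)
        (Z.Eq.trans (eval-resp-≗ {f = f ∘Q inj n} {g = g ∘Q inj n} (go n) t)
          (Z.Eq.sym (hom-at-stage g g-hom n t)))

    Preserves : QuasiEmbedding Union Z → Set ℓ
    Preserves f = (∀ x → to f (Func.to ιᵁ x) Z.≈ Func.to ι x) ×
                  (∀ σ → to f (Func.to κᵁ σ) Z.≈ Func.to κ (to (F₁ f) σ))

    -- As `roll` and `unfold` are mutually inverse, equations about `ιᵁ` and `κᵁ` can be restated as
    -- one equation about decompositions.
    preserves⇒hom : ∀ {f} → Preserves f → IsHom unionCoalgebra f
    preserves⇒hom {f} (f-ι , f-κ) b =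
      Z.Eq.trans (cong f (U.Eq.sym (roll-unfold b))) (at-roll (unfold b))
      where
      at-roll : ∀ t → to f (roll t) Z.≈ Func.to (eval f) t
      at-roll (inj₁ x) = f-ι x
      at-roll (inj₂ σ) = f-κ σ

    hom⇒preserves : ∀ {f} → IsHom unionCoalgebra f → Preserves f
    hom⇒preserves {f} f-hom = (λ x → at-roll (inj₁ x)) , (λ σ → at-roll (inj₂ σ))
      where
      at-roll : ∀ t → to f (roll t) Z.≈ Func.to (eval f) t
      at-roll t = Z.Eq.trans (f-hom (roll t)) (Func.cong (eval f) (unfold-roll t))

    fold-preserves : Preserves fold
    fold-preserves = hom⇒preserves fold-hom

    fold-unique : ∀ {f g} → Preserves f → Preserves g → f ≗ g
    fold-unique f-pres g-pres = hom-unique (preserves⇒hom f-pres) (preserves⇒hom g-pres)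

  isInitialKruskalFixedPoint : IsInitialKruskalFixedPoint W X Union ιᵁ κᵁ
  isInitialKruskalFixedPoint = record
    { isKruskalFixedPoint = union-isKruskalFixedPoint
    ; initial             = λ K → let open Eval K in
        fold , fold-preserves , λ {f} → fold-unique {fold} {f} fold-preserves
    }

  kruskalFixedPoint : KruskalFixedPoint W X
  kruskalFixedPoint = record { isKruskalFixedPoint = union-isKruskalFixedPoint }

-- The action of the derivative on arrows

precompose : {W : PODilator ℓ} {X Y : PO ℓ} → QuasiEmbedding X Y →
             KruskalFixedPoint W Y → KruskalFixedPoint W X
precompose f K = record
  { Z                   = Z
  ; ι                   = record { to = Func.to ι ∘ to f ; cong = Func.cong ι ∘ cong f }
  ; κ                   = κ
  ; isKruskalFixedPoint = record
    { disjoint = λ { z ((x , ιfx≈z) , z∈κ) → disjoint z ((to f x , ιfx≈z) , z∈κ) }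
    ; ι≤ι      = λ x y p → reflects f (ι≤ι (to f x) (to f y) p)
    ; ι≤κ      = λ x → ι≤κ (to f x)
    ; κ≰ι      = λ σ y → κ≰ι σ (to f y)
    ; κ≤κ      = κ≤κ
    }
  }
  where
  open KruskalFixedPoint K
  open IsKruskalFixedPoint isKruskalFixedPoint

module Derivative (W : PODilator ℓ) (normal : Normal W) where

  open PODilator W

  module T X = Stages W normal X
  module U X = Poset (T.Union X)
  module _ {X : PO ℓ} where
    open Stages W normal X public using (child; _◃_; roll; Leaf; here; inside)
  open T using (ιᵁ; κᵁ; leaves) renaming (Union to 𝒯)

  unfold : ∀ {X} → ∣ 𝒯 X ∣ → Setoid.Carrier (T.Branch X (𝒯 X))
  unfold {X} = T.Stage.unfold X (T.unionStage X)

  module _ {X Y : PO ℓ} (f : QuasiEmbedding X Y) where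

    private
      module X = Poset X
      module Y = Poset Y
      module BY = Setoid (T.Branch Y (𝒯 Y))
      module Fold = T.Eval X (precompose f (T.kruskalFixedPoint Y))

    𝒯₁ : QuasiEmbedding (𝒯 X) (𝒯 Y)
    𝒯₁ = Fold.fold

    𝒯₁-ι : ∀ x → to 𝒯₁ (Func.to (ιᵁ X) x) ≈[ 𝒯 Y ] Func.to (ιᵁ Y) (to f x)
    𝒯₁-ι = proj₁ Fold.fold-preserves

    𝒯₁-κ : ∀ σ → to 𝒯₁ (Func.to (κᵁ X) σ) ≈[ 𝒯 Y ] Func.to (κᵁ Y) (to (F₁ 𝒯₁) σ)
    𝒯₁-κ = proj₂ Fold.fold-preserves

    -- All functor laws reduce to this: it is enough that the other side satisfies the two defining
    -- equations of `𝒯₁`.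
    𝒯₁-unique : ∀ g → Fold.Preserves g → 𝒯₁ ≗ g
    𝒯₁-unique g = Fold.fold-unique {𝒯₁} {g} Fold.fold-preserves

    𝒯₁-embedding : IsEmbedding f → IsEmbedding 𝒯₁
    -- The `ι` of the precomposed fixed point is `ιᵁ Y` after `f`, which is monotone once `f` is.
    𝒯₁-embedding f-emb = Fold.fold-embedding (λ x≤y → T.roll-≤-roll⁺ Y (T.leaf (f-emb x≤y)))

    relabel : Setoid.Carrier (T.Branch X (𝒯 X)) → BY.Carrier
    relabel = Sum.map (to f) (to (F₁ 𝒯₁))

    unfold-𝒯₁ : ∀ b → unfold (to 𝒯₁ b) BY.≈ relabel (unfold b)
    unfold-𝒯₁ b = BY.trans (T.Stage.unfold-cong Y (T.unionStage Y) (Fold.fold-hom b))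
                           (at-node (unfold b))
      where
      at-node : ∀ t → unfold (Func.to (Fold.eval 𝒯₁) t) BY.≈ relabel t
      at-node (inj₁ x) = T.unfold-roll Y _
      at-node (inj₂ σ) = T.unfold-roll Y _

    Leaf-relabel⁺ : ∀ {x t} → Leaf {X} x t → Leaf {Y} (to f x) (relabel t)
    Leaf-relabel⁺ (here x≈y) = here (cong f x≈y)
    Leaf-relabel⁺ (inside {b = b} (child b∈σ) x∈b) =
      inside (child (∈-supp⁺ W 𝒯₁ b∈σ))
             (T.Leaf-respʳ Y (BY.sym (unfold-𝒯₁ b)) (Leaf-relabel⁺ x∈b))

    -- Recursion follows the path to the leaf. A child of an image equals the image of a child only
    -- up to equality, hence the extra node `u`.
    Leaf-relabel⁻ : ∀ {y u} t → Leaf {Y} y u → u BY.≈ relabel t →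
                    ∃ λ x → Leaf {X} x t × y Y.≈ to f x
    Leaf-relabel⁻ (inj₁ x) (here y≈z) (inj₁ z≈fx) = x , here X.Eq.refl , Y.Eq.trans y≈z z≈fx
    Leaf-relabel⁻ (inj₂ σ) (inside (child c∈σ′) y∈c) (inj₂ σ′≈fσ) =
      let b , b∈σ , c≈b = ∈-supp⁻ W 𝒯₁ (proj₁ (supp-cong (𝒯 Y) σ′≈fσ) c∈σ′)
          x , x∈b , y≈fx = Leaf-relabel⁻ (unfold b) y∈c
            (BY.trans (T.Stage.unfold-cong Y (T.unionStage Y) {_} {to 𝒯₁ b} c≈b) (unfold-𝒯₁ b))
      in x , inside (child b∈σ) x∈b , y≈fx

    leaves-𝒯₁⁻ : ∀ {y} b → Leaf {Y} y (unfold (to 𝒯₁ b)) →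
                 ∃ λ x → Leaf {X} x (unfold b) × y Y.≈ to f x
    leaves-𝒯₁⁻ b y∈b = Leaf-relabel⁻ (unfold b) y∈b (unfold-𝒯₁ b)

    leaves-natural : ∀ b → leaves Y (to 𝒯₁ b) ≋[ Y ] map (to f) (leaves X b)
    leaves-natural b =
      (λ y∈fb → let x , x∈b , y≈fx = leaves-𝒯₁⁻ b (T.∈-leaves⁻ Y y∈fb)
                in Membershipₚ.∈-resp-≈ Y.Eq.setoid (Y.Eq.sym y≈fx)
                     (Membershipₚ.∈-map⁺ X.Eq.setoid Y.Eq.setoid (cong f) (T.∈-leaves⁺ X x∈b))) ,
      (λ y∈fb → let x , x∈b , y≈fx = Membershipₚ.∈-map⁻ X.Eq.setoid Y.Eq.setoid y∈fb
                in T.∈-leaves⁺ Y (T.Leaf-respˡ Y (Y.Eq.sym y≈fx)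
                     (T.Leaf-respʳ Y (BY.sym (unfold-𝒯₁ b)) (Leaf-relabel⁺ (T.∈-leaves⁻ X x∈b)))))

    module _ (f-emb : IsEmbedding f) where

      -- A leaf has a preimage under `f` directly. For a term, `𝒯₁` is an embedding, so the range
      -- condition of `W` reduces the claim to the children.
      roll-∈rng : ∀ t → (∀ {c} → _◃_ {Y} c t → c ∈rng function 𝒯₁) →
                  (∀ {y} → Leaf {Y} y t → y ∈rng function f) → roll t ∈rng function 𝒯₁
      roll-∈rng (inj₁ y) children leaves =
        let x , fx≈y = leaves (here Y.Eq.refl)
        in roll (inj₁ x) , U.Eq.trans Y (𝒯₁-ι x) (T.roll-cong Y (inj₁ fx≈y))
      roll-∈rng (inj₂ τ) children leaves =
        let σ , fσ≈τ = Equivalence.from (supp-range 𝒯₁ (𝒯₁-embedding f-emb) τ)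
                         (All.tabulateₛ (U.Eq.setoid Y) (children ∘ child))
        in roll (inj₂ σ) , U.Eq.trans Y (𝒯₁-κ σ) (T.roll-cong Y (inj₂ fσ≈τ))

      ∈rng-𝒯₁ : ∀ {b} → Acc (T.Stage._⊏_ Y (T.unionStage Y)) b →
                (∀ {y} → Leaf {Y} y (unfold b) → y ∈rng function f) → b ∈rng function 𝒯₁
      ∈rng-𝒯₁ {b} (acc rs) leaves =
        let a , fa≈ = roll-∈rng (unfold b) (λ c⊏b → ∈rng-𝒯₁ (rs c⊏b) (leaves ∘ inside c⊏b)) leaves
        in a , U.Eq.trans Y fa≈ (T.roll-unfold Y b)

      leaves-range : ∀ b → (b ∈rng function 𝒯₁) ⇔ (leaves Y b ⊆rng function f)
      leaves-range b = mk⇔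
        (λ (a , fa≈b) → All.tabulateₛ Y.Eq.setoid λ y∈b →
          let x , _ , y≈fx = leaves-𝒯₁⁻ a (T.∈-leaves⁻ Y (proj₂ (T.leaves-cong Y fa≈b) y∈b))
          in x , Y.Eq.sym y≈fx)
        (λ b⊆f → ∈rng-𝒯₁ (T.Stage.wellFounded (T.unionStage Y) b)
          (λ y∈b → All.lookupₛ Y.Eq.setoid (λ y≈z (x , fx≈y) → x , Y.Eq.trans fx≈y y≈z)
                     b⊆f (T.∈-leaves⁺ Y y∈b)))

  -- The derivative as a normal PO-dilator

  𝒯-dilator : PODilator ℓ
  𝒯-dilator = record
    { F₀                   = 𝒯
    ; F₁                   = 𝒯₁
    ; F-resp-≗             = λ {X} {Y} {f} {g} f≗g → 𝒯₁-unique f (𝒯₁ g)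
        ( (λ x → U.Eq.trans Y (𝒯₁-ι g x) (Func.cong (ιᵁ Y) (Poset.Eq.sym Y (f≗g x))))
        , 𝒯₁-κ g )
    ; identity             = λ {X} → 𝒯₁-unique idQ idQ
        ( (λ x → U.Eq.refl X)
        , (λ σ → Func.cong (κᵁ X) (Poset.Eq.sym (F₀ (𝒯 X)) (identity σ))) )
    ; homomorphism         = λ {X} {Y} {Z} {f} {g} → 𝒯₁-unique (g ∘Q f) (𝒯₁ g ∘Q 𝒯₁ f)
        ( (λ x → U.Eq.trans Z (cong (𝒯₁ g) (𝒯₁-ι f x)) (𝒯₁-ι g (to f x)))
        , (λ σ → U.Eq.trans Z (cong (𝒯₁ g) (𝒯₁-κ f σ))
                   (U.Eq.trans Z (𝒯₁-κ g (to (F₁ (𝒯₁ f)) σ))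
                     (Func.cong (κᵁ Z) (Poset.Eq.sym (F₀ (𝒯 Z)) (homomorphism σ))))) )
    ; preserves-embeddings = 𝒯₁-embedding
    ; supp                 = leaves
    ; supp-cong            = T.leaves-cong
    ; supp-natural         = leaves-natural
    ; supp-range           = leaves-range
    }

theorem4p2 : (ℓ : Level) (W : PODilator ℓ) → Normal W → KruskalDerivative W
theorem4p2 ℓ W normal = record
  { 𝒯W        = 𝒯-dilator
  ; normal    = λ X → T.leaves-normal X
  ; ι         = T.ιᵁ
  ; κ         = T.κᵁ
  ; isInitial = T.isInitialKruskalFixedPoint
  ; ι-natural = λ {X} {Y} f x → U.Eq.sym Y (𝒯₁-ι f x)
  ; κ-natural = 𝒯₁-κ
  }
  where open Derivative W normal
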